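{- Let $\mathbf{NeurRing}$ be the category whose objects are neural rings and whose morphisms are monomial maps, and let $\mathbf{Code}$ be the category of codes with morphisms of codes. The assignment $R$ sending a code $\mathcal{C}$ to its neural ring $R_{\mathcal{C}}$, and a morphism $f:\mathcal{C}\to\mathcal{D}$ to the ring homomorphism $f^*:R_{\mathcal{D}}\to R_{\mathcal{C}}$, $f^*(p)=p\circ f$ (regarding elements of neural rings as functions on codewords), is a contravariant equivalence of categories $\mathbf{Code}\to\mathbf{NeurRing}$.
   Context: A code is a subset $\mathcal{C}\subseteq 2^{[n]}$; in $\mathbf{Code}$, two codes that are equal as sets of subsets (e.g. $\mathcal{C}\subseteq 2^{[n]}$ regarded also as a subset of $2^{[m]}$, $m\ge n$) are the same object. For $\sigma\subseteq[n]$, $\mathrm{Tk}_{\mathcal{C}}(\sigma)=\{c\in\mathcal{C}\mid\sigma\subseteq c\}$; a trunk in $\mathcal{C}$ is a subset that is empty or of this form. A morphism of codes $f:\mathcal{C}\to\mathcal{D}$ is a function such that preimages of trunks in $\mathcal{D}$ are trunks in $\mathcal{C}$. A polynomial $p\in\mathbb{F}_2[x_1,\dots,x_n]$ defines a function $2^{[n]}\to\mathbb{F}_2$ by setting $x_i=1$ if $i\in c$ and $x_i=0$ otherwise. The vanishing ideal of $\mathcal{C}\subseteq 2^{[n]}$ is $I_{\mathcal{C}}=\{p\in\mathbb{F}_2[x_1,\dots,x_n]\mid p(c)=0\ \forall c\in\mathcal{C}\}$, and the neural ring is $R_{\mathcal{C}}=\mathbb{F}_2[x_1,\dots,x_n]/I_{\mathcal{C}}$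 together with its coordinate functions $x_1,\dots,x_n$; it is identified with the ring of functions $\mathcal{C}\to\mathbb{F}_2$. If $R_{\mathcal{C}}$, $R_{\mathcal{D}}$ have coordinates $x_1,\dots,x_n$ and $y_1,\dots,y_m$, a monomial map $R_{\mathcal{C}}\to R_{\mathcal{D}}$ is a ring homomorphism $\phi$ such that for every monomial $p$ in the $x_i$, $\phi(p)$ is either $0$ or a monomial in the $y_j$. -}

module Defs where

open import Level using (Level; 0ℓ; _⊔_) renaming (suc to lsuc)
open import Algebra.Bundles using (RawRing; CommutativeRing)
open import Algebra.Morphism.Structures using (IsRingHomomorphism; IsRingMonomorphism)
import Algebra.Construct.Pointwise as Pointwise
import Algebra.Definitions.RawSemiring as RawSemiringDefinitions
import Algebra.Morphism.Construct.Composition as Composition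
import Algebra.Morphism.Construct.Identity as Identity
import Algebra.Morphism.RingMonomorphism as RingMonomorphism
open import Data.Bool.Base using (Bool; true; false; T; _xor_)
open import Data.Bool.Properties using (T-irrelevant; xor-∧-commutativeRing)
open import Data.Fin.Base using (toℕ; fromℕ<)
open import Data.Fin.Properties using (any?; toℕ-injective; toℕ<n; toℕ-fromℕ<)
open import Data.Fin.Subset using (Subset; _∈_; _⊆_)
open import Data.Fin.Subset.Properties using (_∈?_; ⊆-antisym)
open import Data.List.Base using (List; []; _∷_; [_]; _++_; map; foldr; cartesianProductWith)
open import Data.Nat.Base as ℕ using (ℕ; zero; suc)
import Data.Nat.Properties as ℕ
open import Data.Product.Base using (Σ-syntax; ∃-syntax; _×_; _,_; proj₁; proj₂)
open import Data.Sum.Base using (_⊎_; inj₁; inj₂)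
open import Data.Vec.Base as Vec using (Vec; []; _∷_; tabulate)
open import Data.Vec.Properties using (lookup∘tabulate; []=⇒lookup; lookup⇒[]=)
open import Function.Base using (_∘′_; id; flip)
open import Function.Bundles using (_⇔_; mk⇔; Equivalence)
open import Relation.Binary.Core using (Rel)
open import Relation.Binary.Structures using (IsEquivalence)
open import Relation.Binary.PropositionalEquality
  using (_≡_; refl; sym; trans; cong; cong₂; subst)
open import Relation.Nullary using (¬_; Dec; yes; no; does; contradiction)
open import Relation.Nullary.Decidable using (_×-dec_)
open import Relation.Unary using (Pred; Empty; _≐_; _⊢_)

-- In the absence of quotients, morphisms are compared by a given
-- equivalence relation.

record Category (o ℓ e : Level) : Set (lsuc (o ⊔ ℓ ⊔ e)) where
  infixr 9 _∘_
  infix  4 _≈_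
  field
    Obj       : Set o
    Hom       : Obj → Obj → Set ℓ
    _≈_       : ∀ {A B} → Rel (Hom A B) e
    idm       : ∀ {A} → Hom A A
    _∘_       : ∀ {A B C} → Hom B C → Hom A B → Hom A C
    assoc     : ∀ {A B C D} (h : Hom C D) (g : Hom B C) (f : Hom A B) →
                (h ∘ g) ∘ f ≈ h ∘ (g ∘ f)
    identityˡ : ∀ {A B} (f : Hom A B) → idm ∘ f ≈ f
    identityʳ : ∀ {A B} (f : Hom A B) → f ∘ idm ≈ f
    equiv     : ∀ {A B} → IsEquivalence (_≈_ {A} {B})
    ∘-resp-≈  : ∀ {A B C} {g g′ : Hom B C} {f f′ : Hom A B} →
                g ≈ g′ → f ≈ f′ → g ∘ f ≈ g′ ∘ f′

_ᵒᵖ : ∀ {o ℓ e} → Category o ℓ e → Category o ℓ e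
C ᵒᵖ = record
  { Obj       = Obj
  ; Hom       = flip Hom
  ; _≈_       = _≈_
  ; idm       = idm
  ; _∘_       = flip _∘_
  ; assoc     = λ h g f → IsEquivalence.sym equiv (assoc f g h)
  ; identityˡ = identityʳ
  ; identityʳ = identityˡ
  ; equiv     = equiv
  ; ∘-resp-≈  = λ p q → ∘-resp-≈ q p
  } where open Category C

record Iso {o ℓ e} (C : Category o ℓ e) (A B : Category.Obj C) : Set (ℓ ⊔ e) where
  open Category C
  field
    to   : Hom A B
    from : Hom B A
    isoˡ : from ∘ to ≈ idm
    isoʳ : to ∘ from ≈ idm

module _ {o ℓ e o′ ℓ′ e′} (C : Category o ℓ e) (D : Category o′ ℓ′ e′) where
  private
    module C = Category C
    module D = Category D

  record IsFunctor (F₀ : C.Obj → D.Obj)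
                   (F₁ : ∀ {A B} → C.Hom A B → D.Hom (F₀ A) (F₀ B))
                   : Set (o ⊔ ℓ ⊔ e ⊔ e′) where
    field
      resp-≈       : ∀ {A B} {f g : C.Hom A B} → f C.≈ g → F₁ f D.≈ F₁ g
      identity     : ∀ {A} → F₁ (C.idm {A}) D.≈ D.idm
      homomorphism : ∀ {X Y Z} (g : C.Hom Y Z) (f : C.Hom X Y) →
                     F₁ (g C.∘ f) D.≈ F₁ g D.∘ F₁ f

  record Functor : Set (o ⊔ ℓ ⊔ e ⊔ o′ ⊔ ℓ′ ⊔ e′) where
    constructor functor
    field
      F₀        : C.Obj → D.Obj
      F₁        : ∀ {A B} → C.Hom A B → D.Hom (F₀ A) (F₀ B)
      isFunctor : IsFunctor F₀ F₁
    open IsFunctor isFunctor public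

idF : ∀ {o ℓ e} {C : Category o ℓ e} → Functor C C
idF {C = C} = record
  { F₀ = id
  ; F₁ = id
  ; isFunctor = record
    { resp-≈       = id
    ; identity     = IsEquivalence.refl equiv
    ; homomorphism = λ _ _ → IsEquivalence.refl equiv
    }
  } where open Category C

infixr 9 _∘F_
_∘F_ : ∀ {o ℓ e o′ ℓ′ e′ o″ ℓ″ e″}
         {C : Category o ℓ e} {D : Category o′ ℓ′ e′} {E : Category o″ ℓ″ e″} →
       Functor D E → Functor C D → Functor C E
_∘F_ {E = E} G F = record
  { F₀ = λ A → G.F₀ (F.F₀ A)
  ; F₁ = λ f → G.F₁ (F.F₁ f)
  ; isFunctor = record
    { resp-≈       = λ p → G.resp-≈ (F.resp-≈ p)
    ; identity     = IsEquivalence.trans equiv (G.resp-≈ F.identity) G.identity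
    ; homomorphism = λ g f → IsEquivalence.trans equiv
                       (G.resp-≈ (F.homomorphism g f))
                       (G.homomorphism (F.F₁ g) (F.F₁ f))
    }
  }
  where
  open Category E
  module F = Functor F
  module G = Functor G

record NaturalIsomorphism {o ℓ e o′ ℓ′ e′}
                          {C : Category o ℓ e} {D : Category o′ ℓ′ e′}
                          (F G : Functor C D) : Set (o ⊔ ℓ ⊔ ℓ′ ⊔ e′) where
  private
    module C = Category C
    module F = Functor F
    module G = Functor G
  open Category D
  field
    iso     : ∀ A → Iso D (F.F₀ A) (G.F₀ A)
    natural : ∀ {A B} (f : C.Hom A B) →
              Iso.to (iso B) ∘ F.F₁ f ≈ G.F₁ f ∘ Iso.to (iso A)

record IsCategoryEquivalence {o ℓ e o′ ℓ′ e′}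
                             {C : Category o ℓ e} {D : Category o′ ℓ′ e′}
                             (F : Functor C D) : Set (o ⊔ ℓ ⊔ e ⊔ o′ ⊔ ℓ′ ⊔ e′) where
  field
    inverse   : Functor D C
    F∘inverse : NaturalIsomorphism (F ∘F inverse) idF
    inverse∘F : NaturalIsomorphism (inverse ∘F F) idF

-- A subset of the finite set 2^[n] is given by its indicator function.

record Code : Set where
  field
    size   : ℕ
    member : Subset size → Bool

open Code public

-- Membership proofs are unique, so ≡ on codewords is equality of the
-- underlying subsets of [n] (see codeword-≡).

Codeword : Code → Set
Codeword C = ∃[ c ] T (member C c)

codeword-≡ : ∀ {C : Code} {c d : Codeword C} → proj₁ c ≡ proj₁ d → c ≡ d
codeword-≡ {c = c , p} {.c , q} refl = cong (c ,_) (T-irrelevant p q)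

Tk : (C : Code) → Subset (size C) → Pred (Codeword C) 0ℓ
Tk C σ c = σ ⊆ proj₁ c

IsTrunk : (C : Code) → Pred (Codeword C) 0ℓ → Set
IsTrunk C P = Empty P ⊎ ∃[ σ ] P ≐ Tk C σ

record CodeMorphism (C D : Code) : Set₁ where
  field
    apply          : Codeword C → Codeword D
    preimage-trunk : ∀ (P : Pred (Codeword D) 0ℓ) → IsTrunk D P → IsTrunk C (apply ⊢ P)

open CodeMorphism public

CodeCategory : Category 0ℓ (lsuc 0ℓ) 0ℓ
CodeCategory = record
  { Obj       = Code
  ; Hom       = CodeMorphism
  ; _≈_       = λ f g → ∀ c → apply f c ≡ apply g c
  ; idm       = record { apply = id ; preimage-trunk = λ _ → id }
  ; _∘_       = λ g f → record
    { apply          = apply g ∘′ apply f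
    ; preimage-trunk = λ P t → preimage-trunk f _ (preimage-trunk g P t)
    }
  ; assoc     = λ _ _ _ _ → refl
  ; identityˡ = λ _ _ → refl
  ; identityʳ = λ _ _ → refl
  ; equiv     = record
    { refl  = λ _ → refl
    ; sym   = λ p c → sym (p c)
    ; trans = λ p q c → trans (p c) (q c)
    }
  ; ∘-resp-≈  = λ {_} {_} {_} {g} p q c → trans (cong (apply g) (q c)) (p _)
  }

-- Codes C ⊆ 2^[n] and D ⊆ 2^[m] with the same elements, as sets of sets
-- of natural numbers, are the same code.  Here they are distinct objects
-- linked by a canonical isomorphism, the identity on codewords
-- (sameCode-iso), so that only object names, and not the category up to
-- equivalence, depend on the ambient n.

infix 4 _∈ℕ_ _∼_

_∈ℕ_ : ∀ {n} → ℕ → Subset n → Set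
k ∈ℕ c = ∃[ i ] toℕ i ≡ k × i ∈ c

_∼_ : ∀ {n m} → Subset n → Subset m → Set
c ∼ d = ∀ k → k ∈ℕ c ⇔ k ∈ℕ d

record SameCode (C D : Code) : Set where
  field
    forth : ∀ (c : Codeword C) → Σ[ d ∈ Codeword D ] proj₁ c ∼ proj₁ d
    back  : ∀ (d : Codeword D) → Σ[ c ∈ Codeword C ] proj₁ d ∼ proj₁ c

private
  ∼⇒≡ : ∀ {n} {c d : Subset n} → c ∼ d → c ≡ d
  ∼⇒≡ c∼d = ⊆-antisym (half (λ k → Equivalence.to (c∼d k)))
                      (half (λ k → Equivalence.from (c∼d k)))
    where
    half : ∀ {n} {c d : Subset n} → (∀ k → k ∈ℕ c → k ∈ℕ d) → c ⊆ d
    half sub {i} i∈c with sub (toℕ i) (i , refl , i∈c)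
    ... | j , j≡i , j∈d = subst (_∈ _) (toℕ-injective j≡i) j∈d

  ∼-trans : ∀ {n m l} {a : Subset n} {b : Subset m} {c : Subset l} →
            a ∼ b → b ∼ c → a ∼ c
  ∼-trans p q k = mk⇔ (Equivalence.to (q k) ∘′ Equivalence.to (p k))
                      (Equivalence.from (p k) ∘′ Equivalence.from (q k))

  module Transport {n m : ℕ} (σ : Subset m) where

    hit? : (k : ℕ) → Dec (k ∈ℕ σ)
    hit? k = any? (λ j → (toℕ j ℕ.≟ k) ×-dec (j ∈? σ))

    restrict : Subset n
    restrict = tabulate (λ i → does (hit? (toℕ i)))

    restrict-sound : ∀ {i} → i ∈ restrict → toℕ i ∈ℕ σ
    restrict-sound {i} i∈ with hit? (toℕ i) | trans (sym (lookup∘tabulate (λ i → does (hit? (toℕ i))) i)) ([]=⇒lookup i∈)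
    ... | yes h | _ = h
    ... | no  _ | ()

    restrict-complete : ∀ {i} → toℕ i ∈ℕ σ → i ∈ restrict
    restrict-complete {i} h = lookup⇒[]= i restrict
      (trans (lookup∘tabulate (λ i → does (hit? (toℕ i))) i) (is-true (hit? (toℕ i))))
      where
      is-true : (d : Dec (toℕ i ∈ℕ σ)) → does d ≡ true
      is-true (yes _) = refl
      is-true (no ¬h) = contradiction h ¬h

  relabel : ∀ {C D : Code} (f : Codeword C → Codeword D) →
            (∀ c → proj₁ c ∼ proj₁ (f c)) → CodeMorphism C D
  relabel {C} {D} f f∼ = record { apply = f ; preimage-trunk = pre }
    where
    pre : ∀ P → IsTrunk D P → IsTrunk C (f ⊢ P)
    pre P (inj₁ ∅) = inj₁ (λ c → ∅ (f c))
    pre P (inj₂ (σ , P⊆ , ⊆P))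
      with any? (λ j → (j ∈? σ) ×-dec (size C ℕ.≤? toℕ j))
    ... | yes (j , j∈σ , n≤j) = inj₁ (λ c Pfc → out c (P⊆ Pfc j∈σ))
      where
      out : ∀ c → ¬ (j ∈ proj₁ (f c))
      out c j∈ with Equivalence.from (f∼ c (toℕ j)) (j , refl , j∈)
      ... | i , i≡j , _ = ℕ.<⇒≱ (subst (ℕ._< size C) i≡j (toℕ<n i)) n≤j
    ... | no ¬big = inj₂ (restrict , (λ {c} → fwd c) , (λ {c} → bwd c))
      where
      open Transport {size C} σ
      fwd : ∀ c → P (f c) → restrict ⊆ proj₁ c
      fwd c Pfc {i} i∈ with restrict-sound i∈
      ... | j , j≡i , j∈σ with Equivalence.from (f∼ c (toℕ i)) (j , j≡i , P⊆ Pfc j∈σ)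
      ... | i′ , i′≡i , i′∈ = subst (_∈ _) (toℕ-injective i′≡i) i′∈
      bwd : ∀ c → restrict ⊆ proj₁ c → P (f c)
      bwd c r⊆c = ⊆P σ⊆
        where
        σ⊆ : σ ⊆ proj₁ (f c)
        σ⊆ {j} j∈σ with size C ℕ.≤? toℕ j
        ... | yes n≤j = contradiction (j , j∈σ , n≤j) ¬big
        ... | no  n≰j = subst (_∈ _) (toℕ-injective (proj₁ (proj₂ e))) (proj₂ (proj₂ e))
          where
          lt = ℕ.≰⇒> n≰j
          i  = fromℕ< lt
          i∈ : i ∈ restrict
          i∈ = restrict-complete (j , sym (toℕ-fromℕ< lt) , j∈σ)
          e : toℕ j ∈ℕ proj₁ (f c)
          e = Equivalence.to (f∼ c (toℕ j)) (i , toℕ-fromℕ< lt , r⊆c i∈)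

sameCode-iso : ∀ {C D : Code} → SameCode C D → Iso CodeCategory C D
sameCode-iso {C} {D} s = record
  { to   = relabel (λ c → proj₁ (forth c)) (λ c → proj₂ (forth c))
  ; from = relabel (λ d → proj₁ (back d)) (λ d → proj₂ (back d))
  ; isoˡ = λ c → codeword-≡ (sym (∼⇒≡ (∼-trans (proj₂ (forth c)) (proj₂ (back _)))))
  ; isoʳ = λ d → codeword-≡ (sym (∼⇒≡ (∼-trans (proj₂ (back d)) (proj₂ (forth _)))))
  } where open SameCode s

𝔽₂ : CommutativeRing 0ℓ 0ℓ
𝔽₂ = xor-∧-commutativeRing

-- The exponent vector e stands for x₁^e₁ ⋯ xₙ^eₙ.

Monomial : ℕ → Set
Monomial n = Vec ℕ n

-- A polynomial is presented as a sum of monomials, in any order and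
-- possibly with repetitions.  Presentations of the same polynomial have
-- the same values, hence become equal modulo any vanishing ideal; only
-- such quotients of 𝔽₂[x₁,…,xₙ] are used.

Polynomial : ℕ → Set
Polynomial n = List (Monomial n)

mono : ∀ {n} → Monomial n → Polynomial n
mono e = [ e ]

infixl 6 _+ₚ_
infixl 7 _*ₚ_

_+ₚ_ _*ₚ_ : ∀ {n} → Polynomial n → Polynomial n → Polynomial n
_+ₚ_ = _++_
_*ₚ_ = cartesianProductWith (Vec.zipWith ℕ._+_)

-- In characteristic 2 every polynomial is its own negative.

-ₚ_ : ∀ {n} → Polynomial n → Polynomial n
-ₚ p = p

0ₚ 1ₚ : ∀ {n} → Polynomial n
0ₚ = []
1ₚ = mono (Vec.replicate _ 0)

module F₂ where
  open CommutativeRing 𝔽₂ public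
  open RawSemiringDefinitions (RawRing.rawSemiring (CommutativeRing.rawRing 𝔽₂)) public using (_^_)

-- A subset c, as a Boolean vector, is the vector of values of x₁,…,xₙ
-- at c.

evalMonomial : ∀ {n} → Monomial n → Subset n → F₂.Carrier
evalMonomial e c = Vec.foldr′ F₂._*_ F₂.1# (Vec.zipWith F₂._^_ c e)

eval : ∀ {n} → Polynomial n → Subset n → F₂.Carrier
eval p c = foldr (λ e v → evalMonomial e c F₂.+ v) F₂.0# p

vanishingIdeal : (C : Code) → Pred (Polynomial (size C)) 0ℓ
vanishingIdeal C p = ∀ (c : Codeword C) → eval p (proj₁ c) ≡ F₂.0#

-- A neural ring is a quotient 𝔽₂[x₁,…,xₙ]/I in which I is the vanishing
-- ideal of some code.

record NeuralRing : Set₁ where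
  field
    code        : Code
    ideal       : Pred (Polynomial (size code)) 0ℓ
    isVanishing : ideal ≐ vanishingIdeal code

  vars : ℕ
  vars = size code

  rawRing : RawRing 0ℓ 0ℓ
  rawRing = record
    { Carrier = Polynomial vars
    ; _≈_     = λ p q → ideal (p +ₚ (-ₚ q))
    ; _+_     = _+ₚ_
    ; _*_     = _*ₚ_
    ; -_      = -ₚ_
    ; 0#      = 0ₚ
    ; 1#      = 1ₚ
    }

  open RawRing rawRing public using (_≈_)

neuralRing : Code → NeuralRing
neuralRing C = record
  { code        = C
  ; ideal       = vanishingIdeal C
  ; isVanishing = id , id
  }

eval-+ : ∀ {n} (p q : Polynomial n) c → eval (p +ₚ q) c ≡ eval p c F₂.+ eval q c
eval-+ []      q c = refl
eval-+ (e ∷ p) q c =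
  trans (cong (evalMonomial e c F₂.+_) (eval-+ p q c))
        (sym (F₂.+-assoc (evalMonomial e c) (eval p c) (eval q c)))

^-+ : ∀ b k l → b F₂.^ (k ℕ.+ l) ≡ (b F₂.^ k) F₂.* (b F₂.^ l)
^-+ b zero    l = refl
^-+ b (suc k) l = trans (cong (b F₂.*_) (^-+ b k l))
                        (sym (F₂.*-assoc b (b F₂.^ k) (b F₂.^ l)))

interchange : ∀ a b c d → (a F₂.* b) F₂.* (c F₂.* d) ≡ (a F₂.* c) F₂.* (b F₂.* d)
interchange false b false d = refl
interchange false b true  d = refl
interchange true  b false d = F₂.zeroʳ b
interchange true  b true  d = refl

evalMonomial-* : ∀ {n} (e f : Monomial n) c →
  evalMonomial (Vec.zipWith ℕ._+_ e f) c ≡ evalMonomial e c F₂.* evalMonomial f c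
evalMonomial-* []      []      []      = refl
evalMonomial-* (k ∷ e) (l ∷ f) (b ∷ c) =
  trans (cong₂ F₂._*_ (^-+ b k l) (evalMonomial-* e f c))
        (interchange (b F₂.^ k) (b F₂.^ l) (evalMonomial e c) (evalMonomial f c))

eval-map : ∀ {n} (e : Monomial n) q c →
  eval (map (Vec.zipWith ℕ._+_ e) q) c ≡ evalMonomial e c F₂.* eval q c
eval-map e []      c = sym (F₂.zeroʳ (evalMonomial e c))
eval-map e (f ∷ q) c =
  trans (cong₂ F₂._+_ (evalMonomial-* e f c) (eval-map e q c))
        (sym (F₂.distribˡ (evalMonomial e c) (evalMonomial f c) (eval q c)))

eval-* : ∀ {n} (p q : Polynomial n) c → eval (p *ₚ q) c ≡ eval p c F₂.* eval q c
eval-* []      q c = refl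
eval-* (e ∷ p) q c =
  trans (eval-+ (map (Vec.zipWith ℕ._+_ e) q) (p *ₚ q) c)
 (trans (cong₂ F₂._+_ (eval-map e q c) (eval-* p q c))
        (sym (F₂.distribʳ (eval q c) (evalMonomial e c) (eval p c))))

evalMonomial-1 : ∀ {n} (c : Subset n) → evalMonomial (Vec.replicate n 0) c ≡ F₂.1#
evalMonomial-1 []      = refl
evalMonomial-1 (b ∷ c) = evalMonomial-1 c

eval-1 : ∀ {n} (c : Subset n) → eval 1ₚ c ≡ F₂.1#
eval-1 c = trans (F₂.+-identityʳ (evalMonomial (Vec.replicate _ 0) c)) (evalMonomial-1 c)

xor≡0⇒≡ : ∀ a b → a xor b ≡ false → a ≡ b
xor≡0⇒≡ false b     p = sym p
xor≡0⇒≡ true  true  p = refl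

module _ (R : NeuralRing) where
  open NeuralRing R

  private
    functionRing : CommutativeRing 0ℓ 0ℓ
    functionRing = Pointwise.commutativeRing (Codeword code) 𝔽₂

  asFunction : Polynomial vars → Codeword code → F₂.Carrier
  asFunction p c = eval p (proj₁ c)

  ≈⇒values : ∀ {p q} → p ≈ q → ∀ c → asFunction p c ≡ asFunction q c
  ≈⇒values {p} {q} p≈q c =
    xor≡0⇒≡ _ _ (trans (sym (eval-+ p q (proj₁ c))) (proj₁ isVanishing p≈q c))

  values⇒≈ : ∀ {p q} → (∀ c → asFunction p c ≡ asFunction q c) → p ≈ q
  values⇒≈ {p} {q} eq = proj₂ isVanishing λ c →
    trans (eval-+ p q (proj₁ c))
   (trans (cong (F₂._+ eval q (proj₁ c)) (eq c)) (F₂.-‿inverseʳ (eval q (proj₁ c))))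

  asFunction-isRingMonomorphism :
    IsRingMonomorphism rawRing (CommutativeRing.rawRing functionRing) asFunction
  asFunction-isRingMonomorphism = record
    { isRingHomomorphism = record
      { isSemiringHomomorphism = record
        { isNearSemiringHomomorphism = record
          { +-isMonoidHomomorphism = record
            { isMagmaHomomorphism = record
              { isRelHomomorphism = record { cong = λ {p} {q} → ≈⇒values {p} {q} }
              ; homo = λ p q c → eval-+ p q (proj₁ c)
              }
            ; ε-homo = λ _ → refl
            }
          ; *-homo = λ p q c → eval-* p q (proj₁ c)
          }
        ; 1#-homo = λ c → eval-1 (proj₁ c)
        }
      ; -‿homo = λ _ _ → refl
      }
    ; injective = λ {p} {q} → values⇒≈ {p} {q}
    }

  neuralRing-commutativeRing : CommutativeRing 0ℓ 0ℓ
  neuralRing-commutativeRing = record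
    { isCommutativeRing =
        RingMonomorphism.isCommutativeRing asFunction-isRingMonomorphism
          (CommutativeRing.isCommutativeRing functionRing)
    }

record MonomialMap (R S : NeuralRing) : Set where
  private
    module R = NeuralRing R
    module S = NeuralRing S
  field
    ⟦_⟧                : Polynomial R.vars → Polynomial S.vars
    isRingHomomorphism : IsRingHomomorphism R.rawRing S.rawRing ⟦_⟧
    monomial           : ∀ (e : Monomial R.vars) →
                         (⟦ mono e ⟧ S.≈ 0ₚ) ⊎ (∃[ e′ ] ⟦ mono e ⟧ S.≈ mono e′)

  open IsRingHomomorphism isRingHomomorphism public

open MonomialMap public using (⟦_⟧)

module Ring (R : NeuralRing) = CommutativeRing (neuralRing-commutativeRing R)

idMap : ∀ {R} → MonomialMap R R
idMap {R} = record
  { ⟦_⟧                = id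
  ; isRingHomomorphism = Identity.isRingHomomorphism _ (λ {p} → Ring.refl R {p})
  ; monomial           = λ e → inj₂ (e , Ring.refl R {mono e})
  }

compose : ∀ {R S U} → MonomialMap S U → MonomialMap R S → MonomialMap R U
compose {R} {S} {U} ψ φ = record
  { ⟦_⟧                = ⟦ ψ ⟧ ∘′ ⟦ φ ⟧
  ; isRingHomomorphism = Composition.isRingHomomorphism
                           (λ {p} {q} {r} → Ring.trans U {p} {q} {r})
                           φ.isRingHomomorphism ψ.isRingHomomorphism
  ; monomial           = mon
  }
  where
  module φ = MonomialMap φ
  module ψ = MonomialMap ψ
  open NeuralRing U using (_≈_)
  then : ∀ {p q r} → p ≈ q → q ≈ r → p ≈ r
  then {p} {q} {r} = Ring.trans U {p} {q} {r}
  mon : ∀ e → (⟦ ψ ⟧ (⟦ φ ⟧ (mono e)) ≈ 0ₚ) ⊎ (∃[ e′ ] ⟦ ψ ⟧ (⟦ φ ⟧ (mono e)) ≈ mono e′)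
  mon e with φ.monomial e
  ... | inj₁ z = inj₁ (then {⟦ ψ ⟧ (⟦ φ ⟧ (mono e))} {⟦ ψ ⟧ 0ₚ} {0ₚ}
                         (ψ.⟦⟧-cong {⟦ φ ⟧ (mono e)} {0ₚ} z) ψ.0#-homo)
  ... | inj₂ (e′ , p) with ψ.monomial e′
  ...   | inj₁ z = inj₁ (then {⟦ ψ ⟧ (⟦ φ ⟧ (mono e))} {⟦ ψ ⟧ (mono e′)} {0ₚ}
                           (ψ.⟦⟧-cong {⟦ φ ⟧ (mono e)} {mono e′} p) z)
  ...   | inj₂ (e″ , q) = inj₂ (e″ , then {⟦ ψ ⟧ (⟦ φ ⟧ (mono e))} {⟦ ψ ⟧ (mono e′)} {mono e″}
                           (ψ.⟦⟧-cong {⟦ φ ⟧ (mono e)} {mono e′} p) q)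

NeurRing : Category (lsuc 0ℓ) 0ℓ 0ℓ
NeurRing = record
  { Obj       = NeuralRing
  ; Hom       = MonomialMap
  ; _≈_       = λ {R} {S} φ ψ → ∀ p → NeuralRing._≈_ S (⟦ φ ⟧ p) (⟦ ψ ⟧ p)
  ; idm       = idMap
  ; _∘_       = compose
  ; assoc     = λ {_} {_} {_} {U} χ ψ φ p → Ring.refl U {⟦ χ ⟧ (⟦ ψ ⟧ (⟦ φ ⟧ p))}
  ; identityˡ = λ {_} {S} φ p → Ring.refl S {⟦ φ ⟧ p}
  ; identityʳ = λ {_} {S} φ p → Ring.refl S {⟦ φ ⟧ p}
  ; equiv     = λ {_} {S} → record
    { refl  = λ {φ} p → Ring.refl S {⟦ φ ⟧ p}
    ; sym   = λ {φ} {ψ} eq p → Ring.sym S {⟦ φ ⟧ p} {⟦ ψ ⟧ p} (eq p)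
    ; trans = λ {φ} {ψ} {χ} eq eq′ p →
                Ring.trans S {⟦ φ ⟧ p} {⟦ ψ ⟧ p} {⟦ χ ⟧ p} (eq p) (eq′ p)
    }
  ; ∘-resp-≈  = λ {_} {_} {U} {ψ} {ψ′} {φ} {φ′} eq eq′ p →
                  Ring.trans U {⟦ ψ ⟧ (⟦ φ ⟧ p)} {⟦ ψ ⟧ (⟦ φ′ ⟧ p)} {⟦ ψ′ ⟧ (⟦ φ′ ⟧ p)}
                    (MonomialMap.⟦⟧-cong ψ {⟦ φ ⟧ p} {⟦ φ′ ⟧ p} (eq′ p)) (eq (⟦ φ′ ⟧ p))
  }

-- φ = f*, that is, φ(p) = p ∘ f as functions on codewords.  Since an
-- element of a neural ring is determined by its values, this determines
-- φ up to equality of monomial maps.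

IsPullback : ∀ {C D : Code} → CodeMorphism C D →
             MonomialMap (neuralRing D) (neuralRing C) → Set
IsPullback {C} {D} f φ =
  ∀ (p : Polynomial (size D)) (c : Codeword C) →
  asFunction (neuralRing C) (⟦ φ ⟧ p) c ≡ asFunction (neuralRing D) p (apply f c)

{-# OPTIONS --safe #-}

-- A monomial takes the value 1 at c exactly when its support is contained
-- in c, so monomials cut out the nonempty trunks.  Hence f* sends monomials
-- to monomials or 0 precisely because preimages of trunks are trunks.
-- Conversely, a ring homomorphism φ followed by evaluation at a codeword c
-- is evaluation at the point d with dᵢ = φ(xᵢ)(c).  If d were not a
-- codeword, its indicator polynomial would vanish on the code, although φ
-- sends it to an element with value 1 at c.  So φ = f* for f(c) = d, and f
-- is a morphism of codes because φ is monomial.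

module Submission where

open import Defs
open import Algebra.Morphism.Structures using (IsRingHomomorphism)
open import Data.Bool.Base using (Bool; true; false; T; if_then_else_)
open import Data.Bool.Properties using (¬-not; T?)
open import Data.Fin.Base using (Fin; zero; suc)
open import Data.Fin.Subset using (Subset; _⊆_)
open import Data.Fin.Subset.Properties using (drop-∷-⊆)
open import Data.List.Base using ([]; _∷_; map; concatMap)
open import Data.Nat.Base as ℕ using (ℕ; zero; suc)
open import Data.Nat.Properties using (+-identityʳ)
open import Data.Product.Base using (Σ-syntax; ∃-syntax; _×_; _,_; proj₁; proj₂)
open import Data.Sum.Base using (_⊎_; inj₁; inj₂)
open import Data.Vec.Base as Vec using ([]; _∷_; here; there; lookup; tabulate; replicate)
open import Data.Vec.Properties
  using (tabulate-cong; tabulate∘lookup; zipWith-identityˡ)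
open import Function.Base using (_∘_; id)
open import Function.Bundles using (_⇔_; mk⇔; Equivalence)
open import Function.Construct.Composition using (_⇔-∘_)
open import Level using (0ℓ)
open import Relation.Binary.PropositionalEquality
  using (_≡_; refl; sym; trans; cong; cong₂; subst; module ≡-Reasoning)
open import Relation.Nullary using (yes; no; contradiction)
open import Relation.Unary using (Pred; _⊢_)

open Equivalence using (to; from)

-- Monomials over the two-element field and their supports.

true-ext : ∀ {a b : Bool} → a ≡ true ⇔ b ≡ true → a ≡ b
true-ext {true}          a⇔b = sym (to a⇔b refl)
true-ext {false} {true}  a⇔b = from a⇔b refl
true-ext {false} {false} a⇔b = refl

*-true : ∀ a b → a F₂.* b ≡ true → a ≡ true × b ≡ true
*-true true b p = refl , p

true^ : ∀ k → true F₂.^ k ≡ true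
true^ zero    = refl
true^ (suc k) = true^ k

support : ∀ {n} → Monomial n → Subset n
support = Vec.map (0 ℕ.<ᵇ_)

-- A section of `support` with exponents 0 and 1, used to turn the set defining a trunk into a
-- monomial.
squarefree : ∀ {n} → Subset n → Monomial n
squarefree = Vec.map (if_then 1 else 0)

support-squarefree : ∀ {n} (σ : Subset n) → support (squarefree σ) ≡ σ
support-squarefree []          = refl
support-squarefree (false ∷ σ) = cong (false ∷_) (support-squarefree σ)
support-squarefree (true  ∷ σ) = cong (true ∷_) (support-squarefree σ)

evalMonomial≡true⇒support⊆ : ∀ {n} (e : Monomial n) c → evalMonomial e c ≡ true → support e ⊆ c
evalMonomial≡true⇒support⊆ (suc k ∷ e) (b ∷ c) p here
  -- A positive power has `b` itself as a factor, so the value 1 forces `b` to be `true`.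
  with refl ← proj₁ (*-true b _ (proj₁ (*-true (b F₂.^ suc k) _ p))) = here
evalMonomial≡true⇒support⊆ (k ∷ e) (b ∷ c) p (there i∈) =
  there (evalMonomial≡true⇒support⊆ e c (proj₂ (*-true (b F₂.^ k) _ p)) i∈)

support⊆⇒evalMonomial≡true : ∀ {n} (e : Monomial n) c → support e ⊆ c → evalMonomial e c ≡ true
support⊆⇒evalMonomial≡true []          []      s = refl
-- Exponent 0 contributes the factor 1 whatever `b` is.
support⊆⇒evalMonomial≡true (zero  ∷ e) (b ∷ c) s = support⊆⇒evalMonomial≡true e c (drop-∷-⊆ s)
support⊆⇒evalMonomial≡true (suc k ∷ e) (b ∷ c) s with here ← s here =
  cong₂ F₂._*_ (true^ (suc k)) (support⊆⇒evalMonomial≡true e c (drop-∷-⊆ s))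

eval-mono : ∀ {n} (e : Monomial n) c → eval (mono e) c ≡ evalMonomial e c
eval-mono e c = F₂.+-identityʳ (evalMonomial e c)

eval-mono≡true : ∀ {n} (e : Monomial n) c → eval (mono e) c ≡ true ⇔ support e ⊆ c
eval-mono≡true e c = mk⇔ fwd bwd
  where
  fwd : eval (mono e) c ≡ true → support e ⊆ c
  fwd p = evalMonomial≡true⇒support⊆ e c (trans (sym (eval-mono e c)) p)
  bwd : support e ⊆ c → eval (mono e) c ≡ true
  bwd s = trans (eval-mono e c) (support⊆⇒evalMonomial≡true e c s)

-- Variables, and multiplicative functions on monomials.

var : ∀ {n} → Fin n → Monomial n
var zero    = 1 ∷ replicate _ 0
var (suc i) = 0 ∷ var i

evalMonomial-var : ∀ {n} (i : Fin n) c → evalMonomial (var i) c ≡ lookup c i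
evalMonomial-var zero (b ∷ c) = begin
  (b F₂.^ 1) F₂.* evalMonomial (replicate _ 0) c ≡⟨ cong ((b F₂.^ 1) F₂.*_) (evalMonomial-1 c) ⟩
  (b F₂.^ 1) F₂.* F₂.1#                          ≡⟨ F₂.*-identityʳ (b F₂.^ 1) ⟩
  b F₂.* F₂.1#                                   ≡⟨ F₂.*-identityʳ b ⟩
  b                                              ∎
  where open ≡-Reasoning
evalMonomial-var (suc i) (b ∷ c) = evalMonomial-var i c

eval-var : ∀ {n} (i : Fin n) c → eval (mono (var i)) c ≡ lookup c i
eval-var i c = trans (eval-mono (var i) c) (evalMonomial-var i c)

-- The variables generate the monoid of monomials, so a multiplicative `χ` is determined by its
-- values on them. The induction splits off the power of the first variable and restricts `χ` to
-- monomials in the others.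
character-evalMonomial : ∀ {n} (χ : Monomial n → F₂.Carrier) →
  χ (replicate n 0) ≡ F₂.1# →
  (∀ e e′ → χ (Vec.zipWith ℕ._+_ e e′) ≡ χ e F₂.* χ e′) →
  ∀ e → χ e ≡ evalMonomial e (tabulate (χ ∘ var))
character-evalMonomial χ χ-1 χ-* [] = χ-1
character-evalMonomial χ χ-1 χ-* (k ∷ e) = begin
  χ (k ∷ e)
    ≡⟨ cong χ (cong₂ _∷_ (+-identityʳ k) (zipWith-identityˡ (λ _ → refl) e)) ⟨
  χ (Vec.zipWith ℕ._+_ (k ∷ replicate _ 0) (0 ∷ e))
    ≡⟨ χ-* (k ∷ replicate _ 0) (0 ∷ e) ⟩
  χ (k ∷ replicate _ 0) F₂.* χ (0 ∷ e)
    ≡⟨ cong₂ F₂._*_ (power k)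
         (character-evalMonomial (χ ∘ (0 ∷_)) χ-1 (λ e e′ → χ-* (0 ∷ e) (0 ∷ e′)) e) ⟩
  evalMonomial (k ∷ e) (tabulate (χ ∘ var)) ∎
  where
  open ≡-Reasoning
  power : ∀ k → χ (k ∷ replicate _ 0) ≡ χ (var zero) F₂.^ k
  power zero    = χ-1
  power (suc k) = begin
    χ (suc k ∷ replicate _ 0)
      ≡⟨ cong (χ ∘ (suc k ∷_)) (zipWith-identityˡ (λ _ → refl) (replicate _ 0)) ⟨
    χ (Vec.zipWith ℕ._+_ (var zero) (k ∷ replicate _ 0))
      ≡⟨ χ-* (var zero) (k ∷ replicate _ 0) ⟩
    χ (var zero) F₂.* χ (k ∷ replicate _ 0)
      ≡⟨ cong (χ (var zero) F₂.*_) (power k) ⟩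
    χ (var zero) F₂.^ suc k ∎

-- Indicator polynomials of single points.

-- The product of xᵢ over i ∈ d and of 1 + xᵢ over i ∉ d, expanded.

indicator : ∀ {n} → Subset n → Polynomial n
indicator []          = 1ₚ
indicator (true  ∷ d) = map (1 ∷_) (indicator d)
indicator (false ∷ d) = map (0 ∷_) (indicator d) +ₚ map (1 ∷_) (indicator d)

eval-map-∷ : ∀ {n} k (p : Polynomial n) b c → eval (map (k ∷_) p) (b ∷ c) ≡ (b F₂.^ k) F₂.* eval p c
eval-map-∷ k []      b c = sym (F₂.zeroʳ (b F₂.^ k))
eval-map-∷ k (e ∷ p) b c = begin
  evalMonomial (k ∷ e) (b ∷ c) F₂.+ eval (map (k ∷_) p) (b ∷ c)
    ≡⟨ cong (evalMonomial (k ∷ e) (b ∷ c) F₂.+_) (eval-map-∷ k p b c) ⟩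
  (b F₂.^ k) F₂.* evalMonomial e c F₂.+ (b F₂.^ k) F₂.* eval p c
    ≡⟨ F₂.distribˡ (b F₂.^ k) (evalMonomial e c) (eval p c) ⟨
  (b F₂.^ k) F₂.* eval (e ∷ p) c ∎
  where open ≡-Reasoning

eval-indicator-false∷ : ∀ {n} (d : Subset n) b c →
  eval (indicator (false ∷ d)) (b ∷ c) ≡ eval (indicator d) c F₂.+ (b F₂.^ 1) F₂.* eval (indicator d) c
eval-indicator-false∷ d b c =
  trans (eval-+ (map (0 ∷_) (indicator d)) (map (1 ∷_) (indicator d)) (b ∷ c))
        (cong₂ F₂._+_ (eval-map-∷ 0 (indicator d) b c) (eval-map-∷ 1 (indicator d) b c))

eval-indicator-self : ∀ {n} (d : Subset n) → eval (indicator d) d ≡ true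
eval-indicator-self []          = refl
eval-indicator-self (true  ∷ d) = trans (eval-map-∷ 1 (indicator d) true d) (eval-indicator-self d)
eval-indicator-self (false ∷ d) =
  trans (eval-indicator-false∷ d false d)
 (trans (F₂.+-identityʳ (eval (indicator d) d)) (eval-indicator-self d))

eval-indicator≡true : ∀ {n} (d c : Subset n) → eval (indicator d) c ≡ true → c ≡ d
eval-indicator≡true []          []          p = refl
eval-indicator≡true (true  ∷ d) (true  ∷ c) p =
  cong (true ∷_) (eval-indicator≡true d c (trans (sym (eval-map-∷ 1 (indicator d) true c)) p))
eval-indicator≡true (true  ∷ d) (false ∷ c) p =
  contradiction (trans (sym p) (eval-map-∷ 1 (indicator d) false c)) λ ()
eval-indicator≡true (false ∷ d) (true  ∷ c) p =
  -- The factor 1 + x becomes 1 + 1 at this coordinate, so the two summands cancel.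
  contradiction
    (trans (sym p) (trans (eval-indicator-false∷ d true c) (F₂.-‿inverseʳ (eval (indicator d) c))))
    λ ()
eval-indicator≡true (false ∷ d) (false ∷ c) p =
  cong (false ∷_) (eval-indicator≡true d c
    (trans (sym (F₂.+-identityʳ (eval (indicator d) c)))
           (trans (sym (eval-indicator-false∷ d false c)) p)))

-- Trunks as loci where a monomial or 0 takes the value 1.

-- The polynomial is read off the evidence, so emptiness of `P` need not be decided. Different
-- evidence for the same `P` gives polynomials with the same values on codewords.
trunkPolynomial : ∀ {C P} → IsTrunk C P → Polynomial (size C)
trunkPolynomial (inj₁ _)       = 0ₚ
trunkPolynomial (inj₂ (σ , _)) = mono (squarefree σ)

eval-trunkPolynomial : ∀ {C P} (t : IsTrunk C P) (c : Codeword C) →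
  eval (trunkPolynomial {C} {P} t) (proj₁ c) ≡ true ⇔ P c
eval-trunkPolynomial (inj₁ ∅) c = mk⇔ (λ ()) (λ Pc → contradiction Pc (∅ c))
eval-trunkPolynomial {C} {P} (inj₂ (σ , P⊆ , ⊆P)) c =
  subst (λ τ → τ ⊆ proj₁ c ⇔ P c) (sym (support-squarefree σ)) (mk⇔ ⊆P (P⊆ {c}))
  ⇔-∘ eval-mono≡true (squarefree σ) (proj₁ c)

mono-trunk : (C : Code) (e : Monomial (size C)) → IsTrunk C (Tk C (support e))
mono-trunk C e = inj₂ (support e , id , id)

-- Ring homomorphisms given by precomposition.

-- A map R → S that acts on functions as precomposition with g is a ring
-- homomorphism, since equality in a neural ring is equality of values.

module _ (R S : NeuralRing) where
  private
    module R = NeuralRing R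
    module S = NeuralRing S

  precomposition-isRingHomomorphism :
    (g : Codeword S.code → Codeword R.code) (h : Polynomial R.vars → Polynomial S.vars) →
    (∀ p c → asFunction S (h p) c ≡ asFunction R p (g c)) →
    IsRingHomomorphism R.rawRing S.rawRing h
  precomposition-isRingHomomorphism g h h-val = record
    { isSemiringHomomorphism = record
      { isNearSemiringHomomorphism = record
        { +-isMonoidHomomorphism = record
          { isMagmaHomomorphism = record
            { isRelHomomorphism = record
              { cong = λ {p} {q} p≈q → values⇒≈ S {h p} {h q} λ c →
                  trans (h-val p c) (trans (≈⇒values R {p} {q} p≈q (g c)) (sym (h-val q c)))
              }
            ; homo = λ p q → values⇒≈ S {h (p +ₚ q)} {h p +ₚ h q} λ c →
                trans (h-val (p +ₚ q) c)
               (trans (eval-+ p q (proj₁ (g c)))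
               (trans (sym (cong₂ F₂._+_ (h-val p c) (h-val q c)))
                      (sym (eval-+ (h p) (h q) (proj₁ c)))))
            }
          ; ε-homo = values⇒≈ S {h 0ₚ} {0ₚ} (h-val 0ₚ)
          }
        ; *-homo = λ p q → values⇒≈ S {h (p *ₚ q)} {h p *ₚ h q} λ c →
            trans (h-val (p *ₚ q) c)
           (trans (eval-* p q (proj₁ (g c)))
           (trans (sym (cong₂ F₂._*_ (h-val p c) (h-val q c)))
                  (sym (eval-* (h p) (h q) (proj₁ c)))))
        }
      ; 1#-homo = values⇒≈ S {h 1ₚ} {1ₚ} λ c →
          trans (h-val 1ₚ c) (trans (eval-1 (proj₁ (g c))) (sym (eval-1 (proj₁ c))))
      }
    ; -‿homo = λ p → values⇒≈ S {h p} {h p} λ _ → refl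
    }

-- The monomial map induced by a morphism of codes.

module Pullback {D C : Code} (f : CodeMorphism C D) where

  onMonomial : Monomial (size D) → Polynomial (size C)
  onMonomial e = trunkPolynomial (preimage-trunk f (Tk D (support e)) (mono-trunk D e))

  -- The additive extension of `onMonomial`. That it respects the vanishing ideals follows from its
  -- values, computed in `eval-onPolynomial`.
  onPolynomial : Polynomial (size D) → Polynomial (size C)
  onPolynomial = concatMap onMonomial

  eval-onMonomial : ∀ e c → eval (onMonomial e) (proj₁ c) ≡ evalMonomial e (proj₁ (apply f c))
  -- Both sides are 1 exactly when the codeword `apply f c` contains the support of `e`.
  eval-onMonomial e c = true-ext (mk⇔
    (λ p → support⊆⇒evalMonomial≡true e _ (to trunk⇔ p))
    (λ p → from trunk⇔ (evalMonomial≡true⇒support⊆ e _ p)))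
    where trunk⇔ = eval-trunkPolynomial (preimage-trunk f (Tk D (support e)) (mono-trunk D e)) c

  eval-onPolynomial : ∀ p c → eval (onPolynomial p) (proj₁ c) ≡ eval p (proj₁ (apply f c))
  eval-onPolynomial []      c = refl
  eval-onPolynomial (e ∷ p) c =
    trans (eval-+ (onMonomial e) (onPolynomial p) (proj₁ c))
          (cong₂ F₂._+_ (eval-onMonomial e c) (eval-onPolynomial p c))

  onMonomial-monomial : ∀ e → onMonomial e ≡ 0ₚ ⊎ ∃[ e′ ] onMonomial e ≡ mono e′
  onMonomial-monomial e with preimage-trunk f (Tk D (support e)) (mono-trunk D e)
  ... | inj₁ _       = inj₁ refl
  ... | inj₂ (σ , _) = inj₂ (squarefree σ , refl)

  -- `onPolynomial (mono e)` is `onMonomial e` with an empty list appended, so the comparison is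
  -- made on values rather than on lists.
  eval-onPolynomial-mono : ∀ e (q : Polynomial (size C)) → onMonomial e ≡ q →
    ∀ c → asFunction (neuralRing C) (onPolynomial (mono e)) c ≡ asFunction (neuralRing C) q c
  eval-onPolynomial-mono e q eq c =
    trans (eval-+ (onMonomial e) 0ₚ (proj₁ c))
   (trans (F₂.+-identityʳ _) (cong (λ r → eval r (proj₁ c)) eq))

  pullback : MonomialMap (neuralRing D) (neuralRing C)
  pullback = record
    { ⟦_⟧                = onPolynomial
    ; isRingHomomorphism = precomposition-isRingHomomorphism (neuralRing D) (neuralRing C)
                             (apply f) onPolynomial eval-onPolynomial
    ; monomial           = mon
    }
    where
    mon : ∀ e → NeuralRing._≈_ (neuralRing C) (onPolynomial (mono e)) 0ₚ
              ⊎ ∃[ e′ ] NeuralRing._≈_ (neuralRing C) (onPolynomial (mono e)) (mono e′)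
    mon e with onMonomial-monomial e
    ... | inj₁ eq        = inj₁ (values⇒≈ (neuralRing C) {onPolynomial (mono e)} {0ₚ}
                                   (eval-onPolynomial-mono e 0ₚ eq))
    ... | inj₂ (e′ , eq) = inj₂ (e′ , values⇒≈ (neuralRing C) {onPolynomial (mono e)} {mono e′}
                                        (eval-onPolynomial-mono e (mono e′) eq))

open Pullback using (pullback; eval-onPolynomial)

-- The morphism of codes induced by a monomial map.

module Dual {R S : NeuralRing} (φ : MonomialMap R S) where
  private
    module R = NeuralRing R
    module S = NeuralRing S
    module φ = MonomialMap φ

  module _ (c : Codeword S.code) where

    point : Subset R.vars
    point = tabulate (λ i → asFunction S (⟦ φ ⟧ (mono (var i))) c)

    eval-point-mono : ∀ e → asFunction S (⟦ φ ⟧ (mono e)) c ≡ evalMonomial e point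
    eval-point-mono = character-evalMonomial (λ e → asFunction S (⟦ φ ⟧ (mono e)) c)
      (trans (≈⇒values S {⟦ φ ⟧ 1ₚ} {1ₚ} φ.1#-homo c) (eval-1 (proj₁ c)))
      (λ e e′ → trans
        -- The product `mono e *ₚ mono e′` computes to the single monomial with the summed
        -- exponents.
        (≈⇒values S {⟦ φ ⟧ (mono e *ₚ mono e′)} {⟦ φ ⟧ (mono e) *ₚ ⟦ φ ⟧ (mono e′)}
          (φ.*-homo (mono e) (mono e′)) c)
        (eval-* (⟦ φ ⟧ (mono e)) (⟦ φ ⟧ (mono e′)) (proj₁ c)))

    eval-point : ∀ p → asFunction S (⟦ φ ⟧ p) c ≡ eval p point
    eval-point []      = ≈⇒values S {⟦ φ ⟧ 0ₚ} {0ₚ} φ.0#-homo c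
    eval-point (e ∷ p) =
      trans (≈⇒values S {⟦ φ ⟧ (mono e +ₚ p)} {⟦ φ ⟧ (mono e) +ₚ ⟦ φ ⟧ p} (φ.+-homo (mono e) p) c)
     (trans (eval-+ (⟦ φ ⟧ (mono e)) (⟦ φ ⟧ p) (proj₁ c))
            (cong₂ F₂._+_ (eval-point-mono e) (eval-point p)))

    point-member : T (member R.code point)
    point-member with T? (member R.code point)
    ... | yes m  = m
    ... | no  ¬m = contradiction
      (trans (sym (eval-indicator-self point))
             (trans (sym (eval-point (indicator point)))
                    (≈⇒values S {⟦ φ ⟧ (indicator point)} {0ₚ} φ-indicator≈0 c)))
      λ ()
      where
      indicator≈0 : indicator point R.≈ 0ₚ
      -- A codeword where the indicator is 1 would equal `point`, which is assumed not to be a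
      -- codeword.
      indicator≈0 = values⇒≈ R {indicator point} {0ₚ} λ d → ¬-not λ p →
        ¬m (subst (T ∘ member R.code) (eval-indicator≡true point (proj₁ d) p) (proj₂ d))
      φ-indicator≈0 : ⟦ φ ⟧ (indicator point) S.≈ 0ₚ
      φ-indicator≈0 = Ring.trans S {⟦ φ ⟧ (indicator point)} {⟦ φ ⟧ 0ₚ} {0ₚ}
        (φ.⟦⟧-cong {indicator point} {0ₚ} indicator≈0) φ.0#-homo

  onCodewords : Codeword S.code → Codeword R.code
  onCodewords c = point c , point-member c

  -- Evaluating the image under `φ` at `c` is evaluating the monomial at `point c`, where the value
  -- 1 means that its support `σ` is contained in the point.
  Tk-onCodewords : ∀ σ c → Tk R.code σ (onCodewords c) ⇔
                           asFunction S (⟦ φ ⟧ (mono (squarefree σ))) c ≡ true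
  Tk-onCodewords σ c = mk⇔
    (λ s → trans val (from iff (λ {i} → s {i})))
    (λ p {i} → to iff (trans (sym val) p) {i})
    where
    val = eval-point c (mono (squarefree σ))
    iff : eval (mono (squarefree σ)) (point c) ≡ true ⇔ σ ⊆ point c
    iff = subst (λ τ → eval (mono (squarefree σ)) (point c) ≡ true ⇔ τ ⊆ point c)
            (support-squarefree σ) (eval-mono≡true (squarefree σ) (point c))

  onCodewords-trunk : ∀ (P : Pred (Codeword R.code) 0ℓ) →
                      IsTrunk R.code P → IsTrunk S.code (onCodewords ⊢ P)
  onCodewords-trunk P (inj₁ ∅) = inj₁ (λ c → ∅ (onCodewords c))
  onCodewords-trunk P (inj₂ (σ , P⊆ , ⊆P)) with φ.monomial (squarefree σ)
  -- If `φ` kills the monomial of `σ`, no image point contains `σ` and the preimage is empty.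
  ... | inj₁ z = inj₁ λ c Pc → contradiction
    (trans (sym (to (Tk-onCodewords σ c) (P⊆ Pc)))
           (≈⇒values S {⟦ φ ⟧ (mono (squarefree σ))} {0ₚ} z c))
    λ ()
  -- Otherwise the preimage is the trunk of the support of the image monomial.
  ... | inj₂ (e , eq) = inj₂ (support e , (λ {c} → fwd c) , (λ {c} → bwd c))
    where
    val : ∀ c → asFunction S (⟦ φ ⟧ (mono (squarefree σ))) c ≡ asFunction S (mono e) c
    val = ≈⇒values S {⟦ φ ⟧ (mono (squarefree σ))} {mono e} eq
    fwd : ∀ c → P (onCodewords c) → support e ⊆ proj₁ c
    fwd c Pc = to (eval-mono≡true e (proj₁ c))
      (trans (sym (val c)) (to (Tk-onCodewords σ c) (P⊆ Pc)))
    bwd : ∀ c → support e ⊆ proj₁ c → P (onCodewords c)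
    bwd c s = ⊆P (from (Tk-onCodewords σ c)
      (trans (val c) (from (eval-mono≡true e (proj₁ c)) s)))

  dual : CodeMorphism S.code R.code
  dual = record { apply = onCodewords ; preimage-trunk = onCodewords-trunk }

open Dual using (dual; eval-point)

-- Functoriality in both directions.

-- The variables read off the coordinates and hence separate codewords. Equations between dual
-- morphisms thus reduce to values of variables, which `eval-point` supplies.
codeword-ext : ∀ {C} {c d : Codeword C} →
  (∀ i → eval (mono (var i)) (proj₁ c) ≡ eval (mono (var i)) (proj₁ d)) → c ≡ d
codeword-ext {C} {c} {d} eq = codeword-≡ {C} (begin
  proj₁ c                     ≡⟨ tabulate∘lookup (proj₁ c) ⟨
  tabulate (lookup (proj₁ c)) ≡⟨ tabulate-cong (λ i →
                                   trans (sym (eval-var i (proj₁ c)))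
                                         (trans (eq i) (eval-var i (proj₁ d)))) ⟩
  tabulate (lookup (proj₁ d)) ≡⟨ tabulate∘lookup (proj₁ d) ⟩
  proj₁ d                     ∎)
  where open ≡-Reasoning

pullback-isFunctor : IsFunctor (CodeCategory ᵒᵖ) NeurRing neuralRing pullback
pullback-isFunctor = record
  { resp-≈ = λ {A} {B} {f} {g} f≈g p → values⇒≈ (neuralRing B) {⟦ pullback f ⟧ p} {⟦ pullback g ⟧ p} λ c →
      trans (eval-onPolynomial f p c)
     (trans (cong (asFunction (neuralRing A) p) (f≈g c)) (sym (eval-onPolynomial g p c)))
  ; identity = λ {A} p → values⇒≈ (neuralRing A) {⟦ pullback (idm {A}) ⟧ p} {p}
      (eval-onPolynomial (idm {A}) p)
  -- Arrows are reversed in the opposite category, so the underlying composite applies `g` first.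
  ; homomorphism = λ {X} {Y} {Z} g f p →
      values⇒≈ (neuralRing Z) {⟦ pullback (f ∘ᶜ g) ⟧ p} {⟦ pullback g ⟧ (⟦ pullback f ⟧ p)} λ c →
        trans (eval-onPolynomial (f ∘ᶜ g) p c)
       (sym (trans (eval-onPolynomial g (⟦ pullback f ⟧ p) c) (eval-onPolynomial f p (apply g c))))
  }
  where open Category CodeCategory using (idm) renaming (_∘_ to _∘ᶜ_)

codeFunctor : Functor NeurRing (CodeCategory ᵒᵖ)
codeFunctor = functor NeuralRing.code dual record
  { resp-≈ = λ {R} {S} {φ} {ψ} φ≈ψ c → codeword-ext {NeuralRing.code R} λ i →
      trans (sym (eval-point φ c (x i)))
     (trans (≈⇒values S {⟦ φ ⟧ (x i)} {⟦ ψ ⟧ (x i)} (φ≈ψ (x i)) c) (eval-point ψ c (x i)))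
  ; identity = λ {R} c → codeword-ext {NeuralRing.code R} λ i → sym (eval-point (idMap {R}) c (x i))
  ; homomorphism = λ {R} {S} {U} ψ φ c → codeword-ext {NeuralRing.code R} λ i →
      trans (sym (eval-point (compose ψ φ) c (x i)))
     (trans (eval-point ψ c (⟦ φ ⟧ (x i))) (eval-point φ (apply (dual ψ) c) (x i)))
  }
  where
  x : ∀ {n} → Fin n → Polynomial n
  x = mono ∘ var

-- The two constructions are mutually inverse up to natural isomorphism.

pullback∘dual : ∀ {R S} (φ : MonomialMap R S) p c →
  asFunction S (⟦ pullback (dual φ) ⟧ p) c ≡ asFunction S (⟦ φ ⟧ p) c
pullback∘dual φ p c = trans (eval-onPolynomial (dual φ) p c) (sym (eval-point φ c p))

dual∘pullback : ∀ {C D} (f : CodeMorphism C D) c → apply (dual (pullback f)) c ≡ apply f c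
dual∘pullback {C} {D} f c = codeword-ext {D} λ i →
  trans (sym (eval-point (pullback f) c (mono (var i)))) (eval-onPolynomial f (mono (var i)) c)

-- R and neuralRing (code R) differ only in the presentation of the ideal.

neuralRing-code-iso : ∀ R → Iso NeurRing (neuralRing (NeuralRing.code R)) R
neuralRing-code-iso R = record
  { to   = record
    { ⟦_⟧                = id
    ; isRingHomomorphism = precomposition-isRingHomomorphism R′ R id id (λ _ _ → refl)
    ; monomial           = λ e → inj₂ (e , Ring.refl R {mono e})
    }
  ; from = record
    { ⟦_⟧                = id
    ; isRingHomomorphism = precomposition-isRingHomomorphism R R′ id id (λ _ _ → refl)
    ; monomial           = λ e → inj₂ (e , Ring.refl R′ {mono e})
    }
  ; isoˡ = λ p → Ring.refl R′ {p}
  ; isoʳ = λ p → Ring.refl R {p}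
  }
  where R′ = neuralRing (NeuralRing.code R)

theorem1p4 : Σ[ R₁ ∈ (∀ {D C : Code} → CodeMorphism C D → MonomialMap (neuralRing D) (neuralRing C)) ]
    (∀ {C D : Code} (f : CodeMorphism C D) → IsPullback f (R₁ f)) ×
    (Σ[ R-isFunctor ∈ IsFunctor (CodeCategory ᵒᵖ) NeurRing neuralRing R₁ ]
    IsCategoryEquivalence (functor {C = CodeCategory ᵒᵖ} {D = NeurRing} neuralRing R₁ R-isFunctor))
theorem1p4 = pullback , eval-onPolynomial , pullback-isFunctor , record
  { inverse   = codeFunctor
  ; F∘inverse = record
    { iso     = neuralRing-code-iso
    -- The components are the identity on polynomials, so the square only compares
    -- `pullback (dual φ)` with `φ`.
    ; natural = λ {R} {S} φ p →
        values⇒≈ S {⟦ pullback (dual φ) ⟧ p} {⟦ φ ⟧ p} (pullback∘dual φ p)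
    }
  ; inverse∘F = record
    -- The code of `neuralRing C` is `C` by definition, so identities serve as components.
    { iso     = λ C → record
      { to = idm {C} ; from = idm {C} ; isoˡ = λ _ → refl ; isoʳ = λ _ → refl }
    ; natural = dual∘pullback
    }
  }
  where open Category CodeCategory using (idm)
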